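{- Let $\mathbb{V}$ be a vector space of dimension $n$ over a field $\mathbb{F}$ with $2$ elements, and let $\Gamma(\mathbb{V})$ be its non-zero component graph with respect to a basis $\{b_1,\ldots,b_n\}$. Then $I(\Gamma(\mathbb{V}))=n$.
   Context: Non-zero component graph: given a finite-dimensional vector space $\mathbb{V}$ over $\mathbb{F}$ with basis $\{b_1,\ldots,b_n\}$ ($n\ge 1$), $\Gamma(\mathbb{V})$ is the simple graph whose vertices are the non-zero vectors of $\mathbb{V}$; two distinct vertices are adjacent if and only if there is some $b_i$ that has non-zero coefficient in the unique linear combinations (with respect to the basis) of both. For a graph $\Gamma$ and a vertex $u$, $N(u)$ is the set of vertices adjacent to $u$ and $N[u]=N(u)\cup\{u\}$ is the closed neighborhood. A set $I_D\subseteq V(\Gamma)$ is an identifying code for $\Gamma$ if $N[u]\cap I_D\ne\emptyset$ for every $u\in V(\Gamma)$ and $N[u]\cap I_D\ne N[v]\cap I_D$ for all distinct $u,v\in V(\Gamma)$. The identifying number $I(\Gamma)$ is the cardinality of a smallest identifying code of $\Gamma$. -}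

module Defs where

open import Algebra.Bundles using (CommutativeRing)
open import Algebra.Module.Bundles using (Module)
import Algebra.Properties.AbelianGroup as AbelianGroupProperties
import Algebra.Properties.CommutativeMonoid.Sum as Sum
open import Data.Fin.Base using (Fin)
open import Data.Nat.Base using (ℕ; _≤_)
open import Data.Product.Base using (Σ; Σ-syntax; ∃-syntax; _×_; _,_; proj₁; proj₂)
open import Function.Bundles using (Inverse)
open import Level using (Level; _⊔_; suc)
open import Relation.Binary.Bundles using (Setoid)
open import Relation.Binary.Core using (Rel)
open import Relation.Binary.Definitions using (Symmetric; _Respects_; _Respects₂_)
import Relation.Binary.Construct.On as On
import Relation.Binary.PropositionalEquality.Properties as ≡
import Relation.Binary.Reasoning.Setoid as SetoidReasoning
open import Relation.Nullary.Negation.Core using (¬_)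
open import Relation.Unary using (Pred; Satisfiable; _∩_; _∪_; _≐_)

------------------------------------------------------------------------
-- Cardinality

-- Elements are counted up to the setoid equality.
HasCardinality : ∀ {a ℓ} → Setoid a ℓ → ℕ → Set (a ⊔ ℓ)
HasCardinality S k = Inverse S (≡.setoid (Fin k))

subsetoid : ∀ {a ℓ p} (S : Setoid a ℓ) → Pred (Setoid.Carrier S) p → Setoid (a ⊔ p) ℓ
subsetoid S P = On.setoid {B = Σ (Setoid.Carrier S) P} S proj₁

------------------------------------------------------------------------
-- Graphs and identifying codes

record SimpleGraph v ℓ e : Set (suc (v ⊔ ℓ ⊔ e)) where
  field
    vertices : Setoid v ℓ

  open Setoid vertices public
    renaming (Carrier to Vertex)

  field
    Adj        : Rel Vertex e
    adj-resp   : Adj Respects₂ _≈_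
    adj-sym    : Symmetric Adj
    adj-irrefl : ∀ {u w} → u ≈ w → ¬ Adj u w

module _ {v ℓ e} (Γ : SimpleGraph v ℓ e) where
  open SimpleGraph Γ

  N : Vertex → Pred Vertex e
  N u = Adj u

  N[_] : Vertex → Pred Vertex (ℓ ⊔ e)
  N[ u ] = N u ∪ (u ≈_)

  record IsIdentifyingCode {p} (D : Pred Vertex p) : Set (v ⊔ ℓ ⊔ e ⊔ p) where
    field
      -- D is a subset of the vertex set, i.e. it does not separate
      -- equal representatives of one vertex.
      resp       : D Respects _≈_
      dominating : ∀ u → Satisfiable (N[ u ] ∩ D)
      separating : ∀ u w → ¬ (u ≈ w) → ¬ ((N[ u ] ∩ D) ≐ (N[ w ] ∩ D))

  -- "I(Γ) = k", where subsets of the vertex set are predicates of an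
  -- arbitrary universe level p.
  record IsIdentifyingNumber (p : Level) (k : ℕ) : Set (v ⊔ ℓ ⊔ e ⊔ suc p) where
    field
      attained : Σ[ D ∈ Pred Vertex p ]
                   IsIdentifyingCode D × HasCardinality (subsetoid vertices D) k
      minimal  : (D : Pred Vertex p) (j : ℕ) →
                 IsIdentifyingCode D → HasCardinality (subsetoid vertices D) j → k ≤ j

------------------------------------------------------------------------
-- Vector spaces

record Field r ℓr : Set (suc (r ⊔ ℓr)) where
  field
    commutativeRing : CommutativeRing r ℓr

  open CommutativeRing commutativeRing public

  field
    1≉0     : 1# ≉ 0#
    inverse : ∀ x → x ≉ 0# → ∃[ y ] x * y ≈ 1#

VectorSpace : ∀ {r ℓr} → Field r ℓr → ∀ m ℓm → Set (r ⊔ ℓr ⊔ suc (m ⊔ ℓm))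
VectorSpace F m ℓm = Module (Field.commutativeRing F) m ℓm

module _ {r ℓr m ℓm} (F : Field r ℓr) (V : VectorSpace F m ℓm) where
  open Field F
  open Module V
  open Sum +ᴹ-commutativeMonoid using (sum; sum-cong-≋; ∑-distrib-+)

  linearCombination : ∀ {n} → (Fin n → Carrier) → (Fin n → Carrierᴹ) → Carrierᴹ
  linearCombination c b = sum (λ i → c i *ₗ b i)

  LinearlyIndependent : ∀ {n} → (Fin n → Carrierᴹ) → Set (r ⊔ ℓr ⊔ ℓm)
  LinearlyIndependent b = ∀ c → linearCombination c b ≈ᴹ 0ᴹ → ∀ i → c i ≈ 0#

  Spanning : ∀ {n} → (Fin n → Carrierᴹ) → Set (r ⊔ m ⊔ ℓm)
  Spanning b = ∀ v → ∃[ c ] linearCombination c b ≈ᴹ v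

  record Basis (n : ℕ) : Set (r ⊔ ℓr ⊔ m ⊔ ℓm) where
    field
      vec                 : Fin n → Carrierᴹ
      linearlyIndependent : LinearlyIndependent vec
      spanning            : Spanning vec

    coeff : Carrierᴹ → Fin n → Carrier
    coeff v = proj₁ (spanning v)

    private
      module A = AbelianGroupProperties +-abelianGroup
      module M = AbelianGroupProperties +ᴹ-abelianGroup

      lc-difference : ∀ c d →
        linearCombination (λ i → c i - d i) vec +ᴹ linearCombination d vec
          ≈ᴹ linearCombination c vec
      lc-difference c d = begin
        linearCombination (λ i → c i - d i) vec +ᴹ linearCombination d vec
          ≈⟨ ∑-distrib-+ (λ i → (c i - d i) *ₗ vec i) (λ i → d i *ₗ vec i) ⟨
        sum (λ i → (c i - d i) *ₗ vec i +ᴹ d i *ₗ vec i)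
          ≈⟨ sum-cong-≋ (λ i → ≈ᴹ-trans (≈ᴹ-sym (*ₗ-distribʳ (vec i) (c i - d i) (d i)))
                                        (*ₗ-congʳ (A.//-rightDividesˡ (d i) (c i)))) ⟩
        linearCombination c vec ∎
        where open SetoidReasoning ≈ᴹ-setoid

    coeff-unique : ∀ v c → linearCombination c vec ≈ᴹ v → ∀ i → coeff v i ≈ c i
    coeff-unique v c c≈v i = A.x∙y⁻¹≈ε⇒x≈y (coeff v i) (c i)
      (linearlyIndependent _
        (M.identityˡ-unique _ _
          (≈ᴹ-trans (lc-difference (coeff v) c)
            (≈ᴹ-trans (proj₂ (spanning v)) (≈ᴹ-sym c≈v)))) i)

    coeff-cong : ∀ {v w} → v ≈ᴹ w → ∀ i → coeff v i ≈ coeff w i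
    coeff-cong {v} {w} v≈w =
      coeff-unique v (coeff w) (≈ᴹ-trans (proj₂ (spanning w)) (≈ᴹ-sym v≈w))

  nonZeroComponentGraph : ∀ {n} → Basis n → SimpleGraph (m ⊔ ℓm) ℓm (ℓr ⊔ ℓm)
  nonZeroComponentGraph B = record
    { vertices   = subsetoid ≈ᴹ-setoid (_≉ᴹ 0ᴹ)
    ; Adj        = λ (u , _) (w , _) →
                     u ≉ᴹ w × ∃[ i ] coeff u i ≉ 0# × coeff w i ≉ 0#
    ; adj-resp   =
        (λ y≈z (x≉y , i , xᵢ , yᵢ) →
          (λ x≈z → x≉y (≈ᴹ-trans x≈z (≈ᴹ-sym y≈z))) ,
          i , xᵢ , λ zᵢ → yᵢ (trans (coeff-cong y≈z i) zᵢ)) ,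
        (λ y≈z (y≉x , i , yᵢ , xᵢ) →
          (λ z≈x → y≉x (≈ᴹ-trans y≈z z≈x)) ,
          i , (λ zᵢ → yᵢ (trans (coeff-cong y≈z i) zᵢ)) , xᵢ)
    ; adj-sym    = λ (u≉w , i , uᵢ , wᵢ) → (λ w≈u → u≉w (≈ᴹ-sym w≈u)) , i , wᵢ , uᵢ
    ; adj-irrefl = λ u≈w (u≉w , _) → u≉w u≈w
    }
    where open Basis B

{-# OPTIONS --safe #-}
-- For a vertex u, the closed neighbourhood N[u] consists of the vectors whose
-- support meets that of u.  So N[u] meets the basis in exactly the support of u,
-- and over a field with two elements a vector is determined by its support:
-- the basis is an identifying code of size n.  Conversely, let D be an
-- identifying code of size j.  Sending a vector v to the set of elements of D
-- whose support meets that of v is injective on all of V: D separates non-zero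
-- vectors, and only the zero vector is sent to the empty set because D is
-- dominating.  Hence 2 ^ n ≤ 2 ^ j.
module Submission where

open import Defs
open import Algebra.Module.Bundles using (Module)
import Algebra.Properties.CommutativeMonoid.Sum as Sum
open import Data.Fin.Base using (Fin; zero; suc; combine; finToFun; funToFin)
open import Data.Fin.Properties
  using (_≟_; any?; all?; injective⇒≤; finToFun-funToFin; funToFin-finToFin)
open import Data.Nat.Base using (ℕ; _≤_; _^_; zero; suc; z<s; s<s)
open import Data.Nat.Properties using (^-monoʳ-<; <⇒≱; ≮⇒≥)
open import Data.Product.Base using (∃; ∃-syntax; _×_; _,_; proj₁; proj₂)
open import Data.Sum.Base using (inj₁; inj₂)
open import Function.Base using (_∘_)
open import Function.Bundles using (Inverse; module Injection)
open import Function.Properties.Inverse using (Inverse⇒Injection)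
open import Level using (Level; Lift; lift; lower)
open import Relation.Binary.Definitions using (Decidable)
open import Relation.Binary.PropositionalEquality as ≡ using (_≡_; _≢_; _≗_)
open import Relation.Nullary.Decidable
  using (Dec; yes; no; True; toWitness; fromWitness; map′; ¬?; _×-dec_;
         decidable-stable; via-injection)
open import Relation.Nullary.Negation using (¬_; contradiction)
open import Relation.Unary using (Pred; _∩_)

-- Counting binary functions.

funToFin-cong : ∀ {m n} {f g : Fin m → Fin n} → f ≗ g → funToFin f ≡ funToFin g
funToFin-cong {zero}  f≗g = ≡.refl
funToFin-cong {suc m} f≗g = ≡.cong₂ combine (f≗g zero) (funToFin-cong (f≗g ∘ suc))

finToFun-injective : ∀ {m n} {x y : Fin (m ^ n)} → finToFun {m} {n} x ≗ finToFun y → x ≡ y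
finToFun-injective {m} {n} {x} {y} eq =
  ≡.trans (≡.sym (funToFin-finToFin {n} {m} x))
    (≡.trans (funToFin-cong eq) (funToFin-finToFin {n} {m} y))

funToFin-injective : ∀ {m n} {f g : Fin m → Fin n} → funToFin f ≡ funToFin g → f ≗ g
funToFin-injective {f = f} {g} eq i =
  ≡.trans (≡.sym (finToFun-funToFin f i))
    (≡.trans (≡.cong (λ x → finToFun x i) eq) (finToFun-funToFin g i))

-- Pigeonhole on the codes in `Fin (2 ^ n)` and `Fin (2 ^ j)`, then strict monotonicity of `2 ^_`.
-- Working with `≗` throughout avoids function extensionality.
injective-on-binary⇒≤ : ∀ {n j} (f : (Fin n → Fin 2) → (Fin j → Fin 2)) →
                        (∀ c d → f c ≗ f d → c ≗ d) → n ≤ j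
injective-on-binary⇒≤ {n} {j} f f-inj = ≮⇒≥ λ j<n →
  <⇒≱ (^-monoʳ-< 2 (s<s z<s) j<n)
    (injective⇒≤ {f = λ x → funToFin (f (finToFun x))}
      (λ eq → finToFun-injective {2} {n} (f-inj _ _ (funToFin-injective eq))))

binary-unique : ∀ {i j k : Fin 2} → i ≢ k → j ≢ k → i ≡ j
binary-unique {zero}     {zero}     {_}        _   _   = ≡.refl
binary-unique {suc zero} {suc zero} {_}        _   _   = ≡.refl
binary-unique {zero}     {suc zero} {zero}     i≢k _   = contradiction ≡.refl i≢k
binary-unique {zero}     {suc zero} {suc zero} _   j≢k = contradiction ≡.refl j≢k
binary-unique {suc zero} {zero}     {zero}     _   j≢k = contradiction ≡.refl j≢k
binary-unique {suc zero} {zero}     {suc zero} i≢k _   = contradiction ≡.refl i≢k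

bit : ∀ {a} {A : Set a} → Dec A → Fin 2
bit (yes _) = suc zero
bit (no  _) = zero

bit-≡⇒→ : ∀ {a b} {A : Set a} {B : Set b} (a? : Dec A) (b? : Dec B) →
          bit a? ≡ bit b? → A → B
bit-≡⇒→ (yes _) (yes b) _ _ = b
bit-≡⇒→ (no ¬a) _       _ a = contradiction a ¬a

-- Kronecker coefficients and linear combinations.

module _ {r ℓr m ℓm} (F : Field r ℓr) (V : VectorSpace F m ℓm) where
  open Field F hiding (zero)
  open Module V
  open Sum +ᴹ-commutativeMonoid using (sum; sum-cong-≋; sum-replicate-zero)

  δ : ∀ {n} → Fin n → Fin n → Carrier
  δ zero    zero    = 1#
  δ zero    (suc _) = 0#
  δ (suc _) zero    = 0#
  δ (suc i) (suc j) = δ i j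

  δ-diag : ∀ {n} (i : Fin n) → δ i i ≈ 1#
  δ-diag zero    = refl
  δ-diag (suc i) = δ-diag i

  δ≉0⇒≡ : ∀ {n} (i j : Fin n) → δ i j ≉ 0# → i ≡ j
  δ≉0⇒≡ zero    zero    _  = ≡.refl
  δ≉0⇒≡ zero    (suc _) ≉0 = contradiction refl ≉0
  δ≉0⇒≡ (suc _) zero    ≉0 = contradiction refl ≉0
  δ≉0⇒≡ (suc i) (suc j) ≉0 = ≡.cong suc (δ≉0⇒≡ i j ≉0)

  lc-zero : ∀ {n} {c : Fin n → Carrier} (b : Fin n → Carrierᴹ) →
            (∀ i → c i ≈ 0#) → linearCombination F V c b ≈ᴹ 0ᴹ
  lc-zero {n} b c≈0 = ≈ᴹ-trans
    (sum-cong-≋ (λ i → ≈ᴹ-trans (*ₗ-congʳ (c≈0 i)) (*ₗ-zeroˡ (b i))))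
    (sum-replicate-zero n)

  lc-δ : ∀ {n} (b : Fin n → Carrierᴹ) i → linearCombination F V (δ i) b ≈ᴹ b i
  lc-δ b zero    = ≈ᴹ-trans
    (+ᴹ-cong (*ₗ-identityˡ (b zero)) (lc-zero (b ∘ suc) (λ _ → refl)))
    (+ᴹ-identityʳ (b zero))
  lc-δ b (suc i) = ≈ᴹ-trans
    (+ᴹ-cong (*ₗ-zeroˡ (b zero)) (lc-δ (b ∘ suc) i))
    (+ᴹ-identityˡ (b (suc i)))

  -- Supports over the two-element field.

  module _ (card : HasCardinality setoid 2) {n} (B : Basis F V n) where
    open Basis B
    module card = Inverse card
    open Injection (Inverse⇒Injection card) using () renaming (injective to card-injective)
    Γ = nonZeroComponentGraph F V B
    open SimpleGraph Γ using (Vertex; vertices)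

    _≈?_ : Decidable _≈_
    _≈?_ = via-injection (Inverse⇒Injection card) _≟_

    ≉0-unique : ∀ {x y} → x ≉ 0# → y ≉ 0# → x ≈ y
    ≉0-unique x≉0 y≉0 = card-injective (binary-unique
      (x≉0 ∘ card-injective) (y≉0 ∘ card-injective))

    coeff-injective : ∀ {v w} → (∀ i → coeff v i ≈ coeff w i) → v ≈ᴹ w
    coeff-injective {v} {w} eq = ≈ᴹ-trans (≈ᴹ-sym (proj₂ (spanning v)))
      (≈ᴹ-trans (sum-cong-≋ (λ i → *ₗ-congʳ (eq i))) (proj₂ (spanning w)))

    -- Coordinates are finitely many and scalars decidable; this supplies the case splits on
    -- equality of vectors below.
    _≈ᴹ?_ : Decidable _≈ᴹ_
    v ≈ᴹ? w = map′ coeff-injective coeff-cong (all? λ i → coeff v i ≈? coeff w i)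

    support : Carrierᴹ → Pred (Fin n) ℓr
    support v i = coeff v i ≉ 0#

    support? : ∀ v i → Dec (support v i)
    support? v i = ¬? (coeff v i ≈? 0#)

    support-cong : ∀ {v w i} → v ≈ᴹ w → support v i → support w i
    support-cong {i = i} v≈w vᵢ wᵢ≈0 = vᵢ (trans (coeff-cong v≈w i) wᵢ≈0)

    support-injective : ∀ {v w} → (∀ i → support v i → support w i) →
                        (∀ i → support w i → support v i) → v ≈ᴹ w
    support-injective {v} {w} v⊆w w⊆v = coeff-injective eq
      where
      eq : ∀ i → coeff v i ≈ coeff w i
      eq i with support? v i | support? w i
      ... | yes vᵢ | _      = ≉0-unique vᵢ (v⊆w i vᵢ)
      ... | no  _  | yes wᵢ = ≉0-unique (w⊆v i wᵢ) wᵢ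
      ... | no ¬vᵢ | no ¬wᵢ = trans (decidable-stable (_ ≈? _) ¬vᵢ)
                                    (sym (decidable-stable (_ ≈? _) ¬wᵢ))

    support-0ᴹ : ∀ {v i} → v ≈ᴹ 0ᴹ → ¬ support v i
    support-0ᴹ {i = i} v≈0 vᵢ =
      -- The all-zero family also represents `v`, so uniqueness makes every coefficient vanish.
      vᵢ (coeff-unique _ (λ _ → 0#) (≈ᴹ-trans (lc-zero vec (λ _ → refl)) (≈ᴹ-sym v≈0)) i)

    -- A vector with empty support has the same support as `0ᴹ`, hence equals it; a finite search
    -- turns this refutation into a witness.
    support-nonempty : ∀ {v} → v ≉ᴹ 0ᴹ → ∃ (support v)
    support-nonempty {v} v≉0 = decidable-stable (any? (support? v)) λ ∄i →
      v≉0 (support-injective (λ i vᵢ → contradiction (i , vᵢ) ∄i)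
                             (λ i 0ᵢ → contradiction 0ᵢ (support-0ᴹ ≈ᴹ-refl)))

    coeff-vec : ∀ i j → coeff (vec i) j ≈ δ i j
    coeff-vec i = coeff-unique (vec i) (δ i) (lc-δ vec i)

    i∈support-vec : ∀ i → support (vec i) i
    i∈support-vec i eq = 1≉0 (trans (sym (trans (coeff-vec i i) (δ-diag i))) eq)

    support-vec : ∀ {i j} → support (vec i) j → i ≡ j
    support-vec {i} {j} ij = δ≉0⇒≡ i j λ δ≈0 → ij (trans (coeff-vec i j) δ≈0)

    vec-injective : ∀ {i j} → vec i ≈ᴹ vec j → i ≡ j
    vec-injective {i} eq = ≡.sym (support-vec (support-cong eq (i∈support-vec i)))

    vecᵛ : Fin n → Vertex
    vecᵛ i = vec i , λ eq → support-0ᴹ eq (i∈support-vec i)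

    -- Adjacency without its distinctness clause. Between vertices it amounts to membership in the
    -- closed neighbourhood, and it also makes sense for `0ᴹ`.
    Meets : Carrierᴹ → Carrierᴹ → Set ℓr
    Meets v w = ∃[ i ] support v i × support w i

    meets? : ∀ v w → Dec (Meets v w)
    meets? v w = any? λ i → support? v i ×-dec support? w i

    N[]⇒meets : ∀ (u w : Vertex) → N[_] Γ u w → Meets (proj₁ u) (proj₁ w)
    N[]⇒meets u         w (inj₁ (_ , meets)) = meets
    -- A non-zero vector meets itself at any index of its support.
    N[]⇒meets (u , u≉0) w (inj₂ u≈w) with support-nonempty u≉0
    ... | i , uᵢ = i , uᵢ , support-cong u≈w uᵢ

    meets⇒N[] : ∀ (u w : Vertex) → Meets (proj₁ u) (proj₁ w) → N[_] Γ u w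
    meets⇒N[] (u , _) (w , _) meets with u ≈ᴹ? w
    ... | yes u≈w = inj₂ u≈w
    ... | no  u≉w = inj₁ (u≉w , meets)

    -- The basis as an identifying code.

    module _ (p : Level) where

      isBasisVector? : ∀ v → Dec (∃[ i ] v ≈ᴹ vec i)
      isBasisVector? v = any? λ i → v ≈ᴹ? vec i

      -- `True` and `Lift` put the predicate in the prescribed universe.
      BasisVector : Pred Vertex p
      BasisVector (v , _) = Lift p (True (isBasisVector? v))

      index : ∀ {v} → BasisVector v → ∃[ i ] proj₁ v ≈ᴹ vec i
      index = toWitness ∘ lower

      basisVector : ∀ {v} i → proj₁ v ≈ᴹ vec i → BasisVector v
      basisVector i v≈bᵢ = lift (fromWitness (i , v≈bᵢ))

      vec∈N[]⇒support : ∀ u {i} → N[_] Γ u (vecᵛ i) → support (proj₁ u) i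
      vec∈N[]⇒support u {i} bᵢ∈N with N[]⇒meets u (vecᵛ i) bᵢ∈N
      ... | k , uₖ , ik with support-vec ik
      ... | ≡.refl = uₖ

      support⇒vec∈N[] : ∀ u {i} → support (proj₁ u) i → N[_] Γ u (vecᵛ i)
      support⇒vec∈N[] u {i} uᵢ = meets⇒N[] u (vecᵛ i) (i , uᵢ , i∈support-vec i)

      -- Each `vecᵛ i` probes a single index: it lies in a closed neighbourhood exactly when `i` is
      -- in the support.
      trace⊆⇒support⊆ : ∀ u w →
        (∀ {x} → (N[_] Γ u ∩ BasisVector) x → (N[_] Γ w ∩ BasisVector) x) →
        ∀ i → support (proj₁ u) i → support (proj₁ w) i
      trace⊆⇒support⊆ u w ⊆ i uᵢ = vec∈N[]⇒support w {i}
        (proj₁ (⊆ {vecᵛ i} (support⇒vec∈N[] u uᵢ , basisVector {vecᵛ i} i ≈ᴹ-refl)))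

      basis-isIdentifyingCode : IsIdentifyingCode Γ BasisVector
      basis-isIdentifyingCode = record
        { resp       = λ {v} {w} v≈w v∈D → let i , v≈bᵢ = index {v} v∈D in
                         basisVector {w} i (≈ᴹ-trans (≈ᴹ-sym v≈w) v≈bᵢ)
        ; dominating = λ u → let i , uᵢ = support-nonempty (proj₂ u) in
                         vecᵛ i , support⇒vec∈N[] u uᵢ , basisVector {vecᵛ i} i ≈ᴹ-refl
        ; separating = λ u w u≉w (⊆ , ⊇) → u≉w (support-injective
                         (trace⊆⇒support⊆ u w (λ {x} → ⊆ {x}))
                         (trace⊆⇒support⊆ w u (λ {x} → ⊇ {x})))
        }

      basis-cardinality : HasCardinality (subsetoid vertices BasisVector) n
      basis-cardinality = record
        { to        = to
        ; from      = λ i → vecᵛ i , basisVector {vecᵛ i} i ≈ᴹ-refl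
        -- Equality in `subsetoid` ignores membership proofs, so the indices they carry are compared
        -- through their basis vectors.
        ; to-cong   = λ {x} {y} x≈y →
                        vec-injective (≈ᴹ-trans (≈ᴹ-sym (to-≈ x)) (≈ᴹ-trans x≈y (to-≈ y)))
        ; from-cong = λ { ≡.refl → ≈ᴹ-refl }
        ; inverse   = (λ {i} {y} y≈bᵢ → vec-injective (≈ᴹ-trans (≈ᴹ-sym (to-≈ y)) y≈bᵢ))
                    , (λ { {x} ≡.refl → ≈ᴹ-sym (to-≈ x) })
        }
        where
        to : ∃ BasisVector → Fin n
        to (v , v∈D) = proj₁ (index {v} v∈D)

        to-≈ : ∀ x → proj₁ (proj₁ x) ≈ᴹ vec (to x)
        to-≈ (v , v∈D) = proj₂ (index {v} v∈D)

    -- The lower bound for an arbitrary code.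

    module _ {p} {D : Pred Vertex p} {j} (code : IsIdentifyingCode Γ D)
             (cardD : HasCardinality (subsetoid vertices D) j) where
      open IsIdentifyingCode code
      module cardD = Inverse cardD

      element : Fin j → Vertex
      element k = proj₁ (cardD.from k)

      meets-element? : ∀ v k → Dec (Meets v (proj₁ (element k)))
      meets-element? v k = meets? v (proj₁ (element k))

      -- The domain includes `0ᴹ`, so that all `2 ^ n` vectors enter the count.
      trace : Carrierᴹ → Fin j → Fin 2
      trace v k = bit (meets-element? v k)

      ∈D⇒element : ∀ {x} → D x → ∃[ k ] proj₁ x ≈ᴹ proj₁ (element k)
      ∈D⇒element {x} x∈D = cardD.to (x , x∈D) , ≈ᴹ-sym (cardD.strictlyInverseʳ (x , x∈D))

      -- Traces only test the enumerated elements, so support membership is carried from `x` to its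
      -- enumerated representative and back.
      trace-≗⇒meets : ∀ {v w} → trace v ≗ trace w → ∀ {x} → D x →
                      Meets v (proj₁ x) → Meets w (proj₁ x)
      trace-≗⇒meets {v} {w} eq {x} x∈D (i , vᵢ , xᵢ) =
        let k , x≈dₖ = ∈D⇒element {x} x∈D
            i′ , wᵢ , dᵢ = bit-≡⇒→ (meets-element? v k) (meets-element? w k) (eq k)
                             (i , vᵢ , support-cong x≈dₖ xᵢ)
        in i′ , wᵢ , support-cong (≈ᴹ-sym x≈dₖ) dᵢ

      trace-≗⇒N[]⊆ : ∀ u w → trace (proj₁ u) ≗ trace (proj₁ w) →
                     ∀ {x} → (N[_] Γ u ∩ D) x → (N[_] Γ w ∩ D) x
      trace-≗⇒N[]⊆ u w eq {x} (x∈N[u] , x∈D) =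
        meets⇒N[] w x (trace-≗⇒meets eq {x} x∈D (N[]⇒meets u x x∈N[u])) , x∈D

      -- Some element of `D` dominates `v`; equal traces make it meet `w` too, so `w` has non-empty
      -- support.
      trace-≗⇒≉0 : ∀ {v w} → trace v ≗ trace w → v ≉ᴹ 0ᴹ → w ≉ᴹ 0ᴹ
      trace-≗⇒≉0 {v} eq v≉0 w≈0 =
        let x , x∈N[v] , x∈D = dominating (v , v≉0)
            i , wᵢ , _       = trace-≗⇒meets eq {x} x∈D (N[]⇒meets (v , v≉0) x x∈N[v])
        in support-0ᴹ w≈0 wᵢ

      trace-injective : ∀ {v w} → trace v ≗ trace w → v ≈ᴹ w
      trace-injective {v} {w} eq with v ≈ᴹ? 0ᴹ | w ≈ᴹ? 0ᴹ
      ... | yes v≈0 | yes w≈0 = ≈ᴹ-trans v≈0 (≈ᴹ-sym w≈0)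
      ... | no  v≉0 | yes w≈0 = contradiction w≈0 (trace-≗⇒≉0 eq v≉0)
      ... | yes v≈0 | no  w≉0 = contradiction v≈0 (trace-≗⇒≉0 (≡.sym ∘ eq) w≉0)
      -- `separating` only refutes `v≉w`; decidable equality recovers `v ≈ᴹ w`.
      ... | no  v≉0 | no  w≉0 = decidable-stable (v ≈ᴹ? w) λ v≉w →
        separating (v , v≉0) (w , w≉0) v≉w
          ( (λ {x} → trace-≗⇒N[]⊆ (v , v≉0) (w , w≉0) eq {x})
          , (λ {x} → trace-≗⇒N[]⊆ (w , w≉0) (v , v≉0) (≡.sym ∘ eq) {x}))

      -- `card` may label `0#` by either bit; only the bijectivity of the labelling matters.
      fromBits : (Fin n → Fin 2) → Carrierᴹ
      fromBits c = linearCombination F V (card.from ∘ c) vec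

      -- Both labelled families represent the same vector, so `coeff-unique` equates them and
      -- `card.to` returns the bits.
      fromBits-injective : ∀ c d → fromBits c ≈ᴹ fromBits d → c ≗ d
      fromBits-injective c d eq i =
        ≡.trans (≡.sym (card.strictlyInverseˡ (c i)))
          (≡.trans (card.to-cong (trans (sym (coeff-unique _ (card.from ∘ c) ≈ᴹ-refl i))
                                 (coeff-unique _ (card.from ∘ d) (≈ᴹ-sym eq) i)))
            (card.strictlyInverseˡ (d i)))

      dimension≤size : n ≤ j
      dimension≤size = injective-on-binary⇒≤ (trace ∘ fromBits)
        (λ c d eq → fromBits-injective c d (trace-injective eq))

theorem2p9 : ∀ {r ℓr m ℓm} (p : Level)
    (F : Field r ℓr) → HasCardinality (Field.setoid F) 2 →
    (V : VectorSpace F m ℓm) (n : ℕ) → 1 ≤ n → (B : Basis F V n) →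
    IsIdentifyingNumber (nonZeroComponentGraph F V B) p n
theorem2p9 p F card V n _ B = record
  { attained = BasisVector F V card B p
             , basis-isIdentifyingCode F V card B p
             , basis-cardinality F V card B p
  ; minimal  = λ D j code cardD → dimension≤size F V card B code cardD
  }
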